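{- Let $p\ge 5$ be a prime, let $C,D\in\mathbb{F}_p$, let $$f(x,y,z)=x^2+y^2+z^2-xyz+C(x+y+z)-D,$$ and put $D_\bullet=4-2C-\frac{C^2}{4}\in\mathbb{F}_p$. Let $N_2(f)$ be the number of $(x,y,z)\in\mathbb{F}_p^3$ with $f(x,y,z)=0$, $(\partial_y f)(x,y,z)=0$ and $(\partial_z f)(x,y,z)=0$. Then the following hold. (i) If $D=D_\bullet$, then $N_2(f)=\big(1+\llbracket C=0\rrbracket\big)p+1-\llbracket C=0\rrbracket-\llbracket C=8\rrbracket$. (ii) If $D\neq D_\bullet$, then $N_2(f)=N_0(\kappa)-\llbracket C=0\rrbracket$, where $N_0(\kappa)$ is the number of distinct roots in $\mathbb{F}_p$ of the cubic $$\kappa(x)=x^3+(C-2)x^2-(2C+D)x+C^2+2D.$$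
   Context: The Iverson bracket $\llbracket \mathcal{S}\rrbracket$ is $1$ if the statement $\mathcal{S}$ is true and $0$ otherwise; equalities such as $C=8$ are in $\mathbb{F}_p$. -}

module Defs where

open import Data.Bool using (if_then_else_)
open import Data.Fin using (Fin; toℕ; _≟_)
open import Data.Fin.Patterns using (0F; 1F; 2F)
open import Data.List using (List; length; filter; find; allFin; cartesianProduct)
open import Data.Maybe using (fromMaybe)
open import Data.Nat as ℕ using (ℕ; zero; suc; NonZero)
open import Data.Nat.DivMod using (_mod_)
open import Data.Product using (_×_; _,_)
open import Data.Vec using (Vec; []; _∷_; lookup)
open import Relation.Binary.PropositionalEquality using (_≡_)
open import Relation.Nullary using (Dec; does)
open import Relation.Nullary.Decidable using (_×-dec_)

⟦_⟧ : ∀ {a} {P : Set a} → Dec P → ℕ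
⟦ P? ⟧ = if does P? then 1 else 0

-- The ring ℤ/p on canonical representatives; it is the field 𝔽_p when p is prime.
module Residues (p : ℕ) .{{_ : NonZero p}} where

  𝔽 : Set
  𝔽 = Fin p

  fromℕ : ℕ → 𝔽
  fromℕ n = n mod p

  infixl 6 _+_ _-_
  infixl 7 _*_ _/_
  infix  8 -_
  infix  9 _⁻¹

  _+_ : 𝔽 → 𝔽 → 𝔽
  a + b = fromℕ (toℕ a ℕ.+ toℕ b)

  _*_ : 𝔽 → 𝔽 → 𝔽
  a * b = fromℕ (toℕ a ℕ.* toℕ b)

  -_ : 𝔽 → 𝔽
  - a = fromℕ (p ℕ.∸ toℕ a)

  _-_ : 𝔽 → 𝔽 → 𝔽
  a - b = a + (- b)

  -- The b with a * b ≡ 1; the default value 0 is taken only when a is not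
  -- invertible, i.e. for p prime only at a ≡ 0.
  _⁻¹ : 𝔽 → 𝔽
  a ⁻¹ = fromMaybe (fromℕ 0) (find (λ b → a * b ≟ fromℕ 1) (allFin p))

  _/_ : 𝔽 → 𝔽 → 𝔽
  a / b = a * b ⁻¹

  -- Polynomial expressions over 𝔽 in n variables.  Each denotes an element of
  -- 𝔽[x₁,…,xₙ]; ∂ is the formal partial derivative (not that of the induced
  -- function) and is compatible with the ring laws, so it does not depend on
  -- how a polynomial is written.

  infixl 6 _⊕_ _⊖_
  infixl 7 _⊗_
  infixr 8 _↑_

  data Poly (n : ℕ) : Set where
    con         : 𝔽 → Poly n
    var         : Fin n → Poly n
    _⊕_ _⊖_ _⊗_ : Poly n → Poly n → Poly n

  _↑_ : ∀ {n} → Poly n → ℕ → Poly n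
  P ↑ zero  = con (fromℕ 1)
  P ↑ suc k = P ⊗ P ↑ k

  eval : ∀ {n} → Poly n → Vec 𝔽 n → 𝔽
  eval (con c) v = c
  eval (var i) v = lookup v i
  eval (P ⊕ Q) v = eval P v + eval Q v
  eval (P ⊖ Q) v = eval P v - eval Q v
  eval (P ⊗ Q) v = eval P v * eval Q v

  ∂ : ∀ {n} → Fin n → Poly n → Poly n
  ∂ i (con c) = con (fromℕ 0)
  ∂ i (var j) = con (fromℕ ⟦ i ≟ j ⟧)
  ∂ i (P ⊕ Q) = ∂ i P ⊕ ∂ i Q
  ∂ i (P ⊖ Q) = ∂ i P ⊖ ∂ i Q
  ∂ i (P ⊗ Q) = ∂ i P ⊗ Q ⊕ P ⊗ ∂ i Q

  Root : ∀ {n} → Poly n → Vec 𝔽 n → Set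
  Root P v = eval P v ≡ fromℕ 0

  root? : ∀ {n} (P : Poly n) (v : Vec 𝔽 n) → Dec (Root P v)
  root? P v = eval P v ≟ fromℕ 0

  𝔽³ : List (𝔽 × 𝔽 × 𝔽)
  𝔽³ = cartesianProduct (allFin p) (cartesianProduct (allFin p) (allFin p))

  N₀ : Poly 1 → ℕ
  N₀ P = length (filter (λ x → root? P (x ∷ [])) (allFin p))

  N₂ : Poly 3 → ℕ
  N₂ P = length (filter common-root? 𝔽³)
    where
    common-root? : (t : 𝔽 × 𝔽 × 𝔽) → let (x , y , z) = t; v = x ∷ y ∷ z ∷ [] in
                   Dec (Root P v × Root (∂ 1F P) v × Root (∂ 2F P) v)
    common-root? (x , y , z) = root? P v ×-dec root? (∂ 1F P) v ×-dec root? (∂ 2F P) v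
      where v = x ∷ y ∷ z ∷ []

  f : 𝔽 → 𝔽 → Poly 3
  f C D = x ↑ 2 ⊕ y ↑ 2 ⊕ z ↑ 2 ⊖ x ⊗ y ⊗ z ⊕ con C ⊗ (x ⊕ y ⊕ z) ⊖ con D
    where
    x = var 0F
    y = var 1F
    z = var 2F

  κ : 𝔽 → 𝔽 → Poly 1
  κ C D = x ↑ 3 ⊕ con (C - fromℕ 2) ⊗ x ↑ 2 ⊖ con (fromℕ 2 * C + D) ⊗ x
            ⊕ con (C * C + fromℕ 2 * D)
    where
    x = var 0F

  D∙ : 𝔽 → 𝔽
  D∙ C = fromℕ 4 - fromℕ 2 * C - C * C / fromℕ 4

open Residues public using (𝔽; fromℕ; f; κ; D∙; N₀; N₂)

{-# OPTIONS --safe #-}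
module Submission where

-- Since f_y - f_z = (x + 2)(y - z), a solution has x = -2 or y = z.
--
-- For y = z and x ≠ 2, f_y = 0 reads y = C / (x - 2), and then f = 0 becomes
-- κ(x) = 0.  At x = 2, f_y = 0 forces C = 0, and indeed κ(2) = C².  There, as
-- well as on the plane x = -2, f ≡ D∙ - D modulo f_y, so no solutions arise if
-- D ≠ D∙, while for D = D∙ the plane x = -2 contributes the line
-- 2y + 2z + C = 0 and, for C = 0, the plane x = 2 the line y = z.
--
-- For D = D∙ moreover κ = (x + 2)(x - r)² with r = 2 - C / 2, so the only other
-- candidate is (r , -2 , -2), which is new precisely when C ≠ 0 (r ≠ 2)
-- and C ≠ 8 (r ≠ -2).

open import Defs
open import Algebra.Bundles using (CommutativeRing)
import Algebra.Consequences.Setoid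
open import Algebra.Solver.Ring.AlmostCommutativeRing
  using (fromCommutativeRing; _-Raw-AlmostCommutative⟶_)
import Algebra.Solver.Ring
open import Algebra.Structures using (IsCommutativeRing)
open import Data.Fin using (Fin; toℕ; _≟_)
open import Data.Fin.Patterns using (1F; 2F)
open import Data.Fin.Properties using (toℕ-fromℕ<; toℕ<n; toℕ-injective)
open import Data.Integer using (ℤ; +_; -[1+_]; +-*-rawRing)
open import Data.Integer.Divisibility.Signed
  using (_∣_; divides; ∣m∣n⇒∣m+n; ∣m⇒∣-m; ∣n⇒∣m*n; ∣⇒∣ᵤ)
import Data.Integer as ℤ
import Data.Integer.Properties as ℤ
open import Data.Integer.Tactic.RingSolver using (solve-∀)
open import Data.List using (List; []; _∷_; _++_; length; map; filter; find; allFin; cartesianProduct)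
open import Data.List.Membership.Propositional using (_∈_)
open import Data.List.Membership.Propositional.Properties
  using (∈-map⁺; ∈-map⁻; ∈-++⁺ˡ; ∈-++⁺ʳ; ∈-++⁻; ∈-filter⁺; ∈-filter⁻; ∈-allFin; ∈-cartesianProduct⁺)
open import Data.List.Membership.Propositional.Properties.WithK using (unique∧set⇒bag)
open import Data.List.Properties using (length-map; length-++; length-tabulate)
open import Data.List.Relation.Binary.BagAndSetEquality using (∼bag⇒↭)
open import Data.List.Relation.Binary.Permutation.Propositional.Properties using (↭-length)
import Data.List.Relation.Unary.All as All
open import Data.List.Relation.Unary.AllPairs using (_∷_)
open import Data.List.Relation.Unary.Any using (here; there)
open import Data.List.Relation.Unary.Unique.Propositional using (Unique)
import Data.List.Relation.Unary.Unique.Propositional.Properties as Unique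
open import Data.Maybe as Maybe using (Maybe; fromMaybe)
open import Data.Nat as ℕ using (ℕ; zero; suc; NonZero; _≤_)
open import Data.Nat.Coprimality using (Coprime; prime⇒coprime; coprime-Bézout)
import Data.Nat.Divisibility as ℕ
open import Data.Nat.DivMod using (m≡m%n+[m/n]*n; m%n<n)
open import Data.Nat.GCD using (module Bézout)
open import Data.Nat.Primality using (Prime; euclidsLemma)
import Data.Nat.Properties as ℕ
open import Data.Product using (_×_; _,_; proj₁; proj₂; ∃)
open import Data.Sum as Sum using (_⊎_; inj₁; inj₂; reduce)
open import Data.Vec using (_∷_; [])
open import Function using (_∘_; id; mk⇔; case_of_)
open import Level using (0ℓ)
open import Relation.Binary.Definitions using (DecidableEquality)
open import Relation.Binary.PropositionalEquality
  using (_≡_; _≢_; refl; sym; trans; cong; cong₂; subst; isEquivalence; setoid; module ≡-Reasoning)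
open import Relation.Nullary using (yes; no; ¬_; contradiction)
open import Relation.Nullary.Decidable using (_×-dec_; ¬?; dec⇒maybe)
open import Relation.Unary using (Decidable; U)

-- Finite counting by duplicate-free lists.

module _ {A : Set} {P : A → Set} (P? : Decidable P) where

  -- The witness `x` guarantees that the search succeeds, so the default `d` is never returned. This
  -- turns the search defining `_⁻¹` into a genuine inverse.
  find-satisfies : ∀ d {x xs} → x ∈ xs → P x → P (fromMaybe d (find P? xs))
  find-satisfies d {xs = y ∷ ys} x∈xs Px with P? y
  find-satisfies d (here refl)   Px | no ¬Py = contradiction Px ¬Py
  find-satisfies d (there x∈ys)  Px | no _   = find-satisfies d x∈ys Px
  find-satisfies d _             Px | yes Py = Py

record Enumeration {A : Set} (P : A → Set) : Set where
  field
    list     : List A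
    unique   : Unique list
    complete : ∀ {x} → P x → x ∈ list
    sound    : ∀ {x} → x ∈ list → P x

module _ {A : Set} {P : A → Set} where

  open Enumeration

  size : Enumeration P → ℕ
  size = length ∘ list

  -- Duplicate-free lists with the same elements are equal as bags, hence permutations of each
  -- other. Every count below compares a filtered list with an explicit one in this way.
  size-unique : ∀ (xs ys : Enumeration P) → size xs ≡ size ys
  size-unique xs ys = ↭-length (∼bag⇒↭ (unique∧set⇒bag (unique xs) (unique ys)
    (mk⇔ (complete ys ∘ sound xs) (complete xs ∘ sound ys))))

enumerate : ∀ {A : Set} {P : A → Set} → Decidable P → Enumeration (U {A = A}) → Enumeration P
enumerate P? as = record
  { list     = filter P? (list as)
  ; unique   = Unique.filter⁺ P? (unique as)
  ; complete = ∈-filter⁺ P? (complete as _)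
  ; sound    = proj₂ ∘ ∈-filter⁻ P? {xs = list as}
  }
  where open Enumeration

transport : ∀ {A : Set} {P Q : A → Set} → (∀ {x} → P x → Q x) → (∀ {x} → Q x → P x) → Enumeration P → Enumeration Q
transport P⇒Q Q⇒P xs = record { list = list ; unique = unique ; complete = complete ∘ Q⇒P ; sound = P⇒Q ∘ sound }
  where open Enumeration xs

infixr 5 _⊗_

_⊗_ : ∀ {A B : Set} → Enumeration (U {A = A}) → Enumeration (U {A = B}) → Enumeration (U {A = A × B})
xs ⊗ ys = record
  { list     = cartesianProduct (list xs) (list ys)
  ; unique   = Unique.cartesianProduct⁺ (unique xs) (unique ys)
  ; complete = λ _ → ∈-cartesianProduct⁺ (complete xs _) (complete ys _)
  ; sound    = _
  }
  where open Enumeration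

enumerate-Fin : ∀ n → Enumeration (U {A = Fin n})
enumerate-Fin n = record { list = allFin n ; unique = Unique.allFin⁺ n ; complete = λ {i} _ → ∈-allFin i ; sound = _ }

-- Residues modulo p compared with integers.

module Congruence (p : ℕ) .{{_ : NonZero p}} where

  open import Data.Integer using (+_; _+_; _-_; _*_; -_)
  private module R = Residues p

  infix 4 _~_

  -- Taking `u` in ℤ lets integer identities act on residues directly. A record allows `a` and `u`
  -- to be inferred from a proof.
  record _~_ (a : 𝔽 p) (u : ℤ) : Set where
    constructor mk
    field p∣a-u : + p ∣ + toℕ a - u

  toℕ-~ : ∀ a → a ~ + toℕ a
  toℕ-~ a = mk (divides (+ 0) (ℤ.+-inverseʳ (+ toℕ a)))

  ~-trans : ∀ {a u v} → a ~ u → + p ∣ u - v → a ~ v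
  ~-trans {a} {u} {v} (mk p∣a-u) p∣u-v = mk (subst (+ p ∣_) (ring (+ toℕ a) u v) (∣m∣n⇒∣m+n p∣a-u p∣u-v))
    where
    ring : ∀ a u v → (a - u) + (u - v) ≡ a - v
    ring = solve-∀

  fromℕ-~ : ∀ n → fromℕ p n ~ + n
  fromℕ-~ n = mk (divides (- + (n ℕ./ p)) (begin
    + toℕ (fromℕ p n) - + n                            ≡⟨ cong₂ (λ r m → + r - m) (toℕ-fromℕ< (m%n<n n p)) n≡ ⟩
    + (n ℕ.% p) - (+ (n ℕ.% p) + + (n ℕ./ p) * + p)    ≡⟨ ring (+ (n ℕ.% p)) (+ (n ℕ./ p)) (+ p) ⟩
    - + (n ℕ./ p) * + p                                ∎))
    where
    open ≡-Reasoning
    n≡ : + n ≡ + (n ℕ.% p) + + (n ℕ./ p) * + p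
    n≡ = trans (cong +_ (m≡m%n+[m/n]*n n p))
               (trans (ℤ.pos-+ (n ℕ.% p) _) (cong (_+_ (+ (n ℕ.% p))) (ℤ.pos-* (n ℕ./ p) p)))
    ring : ∀ r q m → r - (r + q * m) ≡ - q * m
    ring = solve-∀

  fromℕ-~′ : ∀ n {u} → + n ≡ u → fromℕ p n ~ u
  fromℕ-~′ n refl = fromℕ-~ n

  +-~ : ∀ {a b u v} → a ~ u → b ~ v → a R.+ b ~ u + v
  +-~ {a} {b} {u} {v} (mk a~u) (mk b~v) = ~-trans
    (fromℕ-~′ (toℕ a ℕ.+ toℕ b) (ℤ.pos-+ (toℕ a) (toℕ b)))
    (subst (+ p ∣_) (ring (+ toℕ a) (+ toℕ b) u v) (∣m∣n⇒∣m+n a~u b~v))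
    where
    ring : ∀ a b u v → (a - u) + (b - v) ≡ (a + b) - (u + v)
    ring = solve-∀

  *-~ : ∀ {a b u v} → a ~ u → b ~ v → a R.* b ~ u * v
  *-~ {a} {b} {u} {v} (mk a~u) (mk b~v) = ~-trans
    (fromℕ-~′ (toℕ a ℕ.* toℕ b) (ℤ.pos-* (toℕ a) (toℕ b)))
    (subst (+ p ∣_) (ring (+ toℕ a) (+ toℕ b) u v)
      (∣m∣n⇒∣m+n (∣n⇒∣m*n (+ toℕ b) a~u) (∣n⇒∣m*n u b~v)))
    where
    ring : ∀ a b u v → b * (a - u) + u * (b - v) ≡ a * b - u * v
    ring = solve-∀

  -‿~ : ∀ {a u} → a ~ u → R.- a ~ - u
  -‿~ {a} {u} (mk a~u) = ~-trans (fromℕ-~′ (p ℕ.∸ toℕ a) p∸a)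
    (subst (+ p ∣_) (ring (+ p) (+ toℕ a) u)
      (∣m∣n⇒∣m+n (∣m⇒∣-m a~u) (divides (+ 1) (sym (ℤ.*-identityˡ (+ p))))))
    where
    p∸a : + (p ℕ.∸ toℕ a) ≡ + p - + toℕ a
    p∸a = sym (trans (ℤ.m-n≡m⊖n p (toℕ a)) (ℤ.⊖-≥ (ℕ.<⇒≤ (toℕ<n a))))
    ring : ∀ p a u → - (a - u) + p ≡ p - a - - u
    ring = solve-∀

  ∣∧<⇒≡0 : ∀ {n} → p ℕ.∣ n → n ℕ.< p → n ≡ 0
  ∣∧<⇒≡0 {zero}  _   _   = refl
  ∣∧<⇒≡0 {suc n} p∣n n<p = contradiction p∣n (ℕ.>⇒∤ n<p)

  -- Representatives lie below p, so the difference of two congruent ones is a multiple of p smaller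
  -- than p, hence zero.
  ~-injective : ∀ {a b u} → a ~ u → b ~ u → a ≡ b
  ~-injective a~u b~u = toℕ-injective (ℕ.≤-antisym (below a~u b~u) (below b~u a~u))
    where
    below : ∀ {a b u} → a ~ u → b ~ u → toℕ a ≤ toℕ b
    below {a} {b} {u} (mk a~u) (mk b~u) with ℕ.≤-total (toℕ a) (toℕ b)
    ... | inj₁ a≤b = a≤b
    ... | inj₂ b≤a = ℕ.m∸n≡0⇒m≤n (∣∧<⇒≡0 (∣⇒∣ᵤ (subst (+ p ∣_) difference (∣m∣n⇒∣m+n a~u (∣m⇒∣-m b~u))))
                                        (ℕ.≤-<-trans (ℕ.m∸n≤m (toℕ a) (toℕ b)) (toℕ<n a)))
      where
      ring : ∀ a b u → (a - u) + - (b - u) ≡ a - b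
      ring = solve-∀
      difference : (+ toℕ a - u) + - (+ toℕ b - u) ≡ + (toℕ a ℕ.∸ toℕ b)
      difference = trans (ring (+ toℕ a) (+ toℕ b) u) (trans (ℤ.m-n≡m⊖n (toℕ a) (toℕ b)) (ℤ.⊖-≥ b≤a))

  ~∧≡0⇒∣ : ∀ {a n} → a ~ + n → a ≡ fromℕ p 0 → p ℕ.∣ n
  ~∧≡0⇒∣ {n = n} (mk p∣a-n) refl = ∣⇒∣ᵤ (subst (+ p ∣_) (ring (+ toℕ (fromℕ p 0)) (+ n))
    (∣m∣n⇒∣m+n (_~_.p∣a-u (fromℕ-~ 0)) (∣m⇒∣-m p∣a-n)))
    where
    ring : ∀ a u → (a - + 0) + - (a - u) ≡ u
    ring = solve-∀

  fromℕ≢0 : ∀ n .{{_ : NonZero n}} → n ℕ.< p → fromℕ p n ≢ fromℕ p 0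
  fromℕ≢0 n n<p n≡0 = ℕ.≢-nonZero⁻¹ n (∣∧<⇒≡0 (~∧≡0⇒∣ (fromℕ-~ n) n≡0) n<p)

  toℕ≡0⇒≡0 : ∀ {a} → toℕ a ≡ 0 → a ≡ fromℕ p 0
  toℕ≡0⇒≡0 {a} a≡0 = ~-injective (subst (λ n → a ~ + n) a≡0 (toℕ-~ a)) (fromℕ-~ 0)

  pos-1+* : ∀ k l m n → 1 ℕ.+ k ℕ.* l ≡ m ℕ.* n → + 1 + + k * + l ≡ + m * + n
  pos-1+* k l m n eq = trans (cong (_+_ (+ 1)) (sym (ℤ.pos-* k l))) (trans (cong +_ eq) (ℤ.pos-* m n))

  -- Bézout over ℕ comes with two signs: 1 + y a = x p gives the inverse -y, and 1 + x p = y a gives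
  -- the inverse y.
  coprime⇒invertible : ∀ a → Coprime p (toℕ a) → ∃ λ b → a R.* b ≡ fromℕ p 1
  coprime⇒invertible a coprime with coprime-Bézout coprime
  ... | Bézout.+- x y eq = R.- fromℕ p y ,
    ~-injective (*-~ (toℕ-~ a) (-‿~ (fromℕ-~ y))) (~-trans (fromℕ-~ 1) (divides (+ x)
      (trans (ring (+ toℕ a) (+ y)) (pos-1+* y (toℕ a) x p eq))))
    where
    ring : ∀ a y → + 1 - a * - y ≡ + 1 + y * a
    ring = solve-∀
  ... | Bézout.-+ x y eq = fromℕ p y ,
    ~-injective (~-trans (*-~ (toℕ-~ a) (fromℕ-~ y)) (divides (+ x)
      (trans (cong (_- + 1) (ℤ.*-comm (+ toℕ a) (+ y)))
        (trans (cong (_- + 1) (sym (pos-1+* x p y (toℕ a) eq))) (ring (+ x) (+ p)))))) (fromℕ-~ 1)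
    where
    ring : ∀ x p → + 1 + x * p - + 1 ≡ x * p
    ring = solve-∀

  -- Each law is inherited from ℤ: its two sides are congruent to integers that ℤ already
  -- identifies, and `~-injective` does the rest.
  commutativeRing : CommutativeRing 0ℓ 0ℓ
  commutativeRing = record
    { Carrier = 𝔽 p ; _≈_ = _≡_ ; _+_ = R._+_ ; _*_ = R._*_ ; -_ = R.-_ ; 0# = fromℕ p 0 ; 1# = fromℕ p 1
    ; isCommutativeRing = record
      { isRing = record
        { +-isAbelianGroup = record
          { isGroup = record
            { isMonoid = record
              { isSemigroup = record
                { isMagma = record { isEquivalence = isEquivalence ; ∙-cong = cong₂ R._+_ }
                ; assoc = λ a b c → via (ℤ.+-assoc (+ toℕ a) (+ toℕ b) (+ toℕ c))
                    (+-~ (+-~ (toℕ-~ a) (toℕ-~ b)) (toℕ-~ c)) (+-~ (toℕ-~ a) (+-~ (toℕ-~ b) (toℕ-~ c)))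
                }
              ; identity = comm∧idˡ⇒id +-comm λ a →
                  via (ℤ.+-identityˡ (+ toℕ a)) (+-~ (fromℕ-~ 0) (toℕ-~ a)) (toℕ-~ a)
              }
            ; inverse = comm∧invˡ⇒inv +-comm λ a →
                via (ℤ.+-inverseˡ (+ toℕ a)) (+-~ (-‿~ (toℕ-~ a)) (toℕ-~ a)) (fromℕ-~ 0)
            ; ⁻¹-cong = cong (λ a → R.- a)
            }
          ; comm = +-comm
          }
        ; *-cong = cong₂ R._*_
        ; *-assoc = λ a b c → via (ℤ.*-assoc (+ toℕ a) (+ toℕ b) (+ toℕ c))
            (*-~ (*-~ (toℕ-~ a) (toℕ-~ b)) (toℕ-~ c)) (*-~ (toℕ-~ a) (*-~ (toℕ-~ b) (toℕ-~ c)))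
        ; *-identity = comm∧idˡ⇒id *-comm λ a →
            via (ℤ.*-identityˡ (+ toℕ a)) (*-~ (fromℕ-~ 1) (toℕ-~ a)) (toℕ-~ a)
        ; distrib = comm∧distrˡ⇒distr {_∙_ = R._*_} {_◦_ = R._+_} (cong₂ R._+_) *-comm λ a b c →
            via (ℤ.*-distribˡ-+ (+ toℕ a) (+ toℕ b) (+ toℕ c))
              (*-~ (toℕ-~ a) (+-~ (toℕ-~ b) (toℕ-~ c)))
              (+-~ (*-~ (toℕ-~ a) (toℕ-~ b)) (*-~ (toℕ-~ a) (toℕ-~ c)))
        }
      ; *-comm = *-comm
      }
    }
    where
    open Algebra.Consequences.Setoid (setoid (𝔽 p))
    via : ∀ {a b u v} → u ≡ v → a ~ u → b ~ v → a ≡ b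
    via refl = ~-injective
    +-comm : ∀ a b → a R.+ b ≡ b R.+ a
    +-comm a b = via (ℤ.+-comm (+ toℕ a) (+ toℕ b)) (+-~ (toℕ-~ a) (toℕ-~ b)) (+-~ (toℕ-~ b) (toℕ-~ a))
    *-comm : ∀ a b → a R.* b ≡ b R.* a
    *-comm a b = via (ℤ.*-comm (+ toℕ a) (+ toℕ b)) (*-~ (toℕ-~ a) (toℕ-~ b)) (*-~ (toℕ-~ b) (toℕ-~ a))

  fromℤ : ℤ → 𝔽 p
  fromℤ (+ n)    = fromℕ p n
  fromℤ -[1+ n ] = R.- fromℕ p (suc n)

  fromℤ-~ : ∀ u → fromℤ u ~ u
  fromℤ-~ (+ n)    = fromℕ-~ n
  fromℤ-~ -[1+ n ] = -‿~ (fromℕ-~ (suc n))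

-- Abstract fields and ring solving with integer coefficients.

-- The operations are kept abstract, so that unification never unfolds the
-- arithmetic of residues; fromℤ makes integer coefficients available to the
-- ring solver.
record Field : Set₁ where
  infixl 6 _+_ _-_
  infixl 7 _*_ _/_
  infix  8 -_
  infix  9 _⁻¹
  field
    Carrier : Set
    _+_ _*_ : Carrier → Carrier → Carrier
    -_ _⁻¹  : Carrier → Carrier
    fromℤ   : ℤ → Carrier
    isCommutativeRing : IsCommutativeRing _≡_ _+_ _*_ -_ (fromℤ (+ 0)) (fromℤ (+ 1))
    +-homo : ∀ m n → fromℤ (m ℤ.+ n) ≡ fromℤ m + fromℤ n
    *-homo : ∀ m n → fromℤ (m ℤ.* n) ≡ fromℤ m * fromℤ n
    -‿homo : ∀ m → fromℤ (ℤ.- m) ≡ - fromℤ m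
    integral : ∀ a b → a * b ≡ fromℤ (+ 0) → a ≡ fromℤ (+ 0) ⊎ b ≡ fromℤ (+ 0)
    *-inverseʳ : ∀ {a} → a ≢ fromℤ (+ 0) → a * a ⁻¹ ≡ fromℤ (+ 1)

  open IsCommutativeRing isCommutativeRing public using (+-comm)

  _-_ _/_ : Carrier → Carrier → Carrier
  a - b = a + - b
  a / b = a * b ⁻¹

  0# 1# : Carrier
  0# = fromℤ (+ 0)
  1# = fromℤ (+ 1)

  commutativeRing : CommutativeRing 0ℓ 0ℓ
  commutativeRing = record { isCommutativeRing = isCommutativeRing }

  fromℤ-homomorphism : +-*-rawRing -Raw-AlmostCommutative⟶ fromCommutativeRing commutativeRing
  fromℤ-homomorphism = record
    { ⟦_⟧    = fromℤ
    ; +-homo = +-homo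
    ; *-homo = *-homo
    ; -‿homo = -‿homo
    ; 0-homo = refl
    ; 1-homo = refl
    }

  -- Coefficients are compared as integers, so the solver proves identities that hold in every
  -- characteristic.
  fromℤ-≟ : ∀ m n → Maybe (fromℤ m ≡ fromℤ n)
  fromℤ-≟ m n = Maybe.map (cong fromℤ) (dec⇒maybe (m ℤ.≟ n))

  module Solver = Algebra.Solver.Ring +-*-rawRing (fromCommutativeRing commutativeRing) fromℤ-homomorphism fromℤ-≟
  open Solver

  a≢0∧a*b≡0⇒b≡0 : ∀ {a b} → a ≢ 0# → a * b ≡ 0# → b ≡ 0#
  a≢0∧a*b≡0⇒b≡0 {a} {b} a≢0 ab≡0 with integral a b ab≡0
  ... | inj₁ a≡0 = contradiction a≡0 a≢0
  ... | inj₂ b≡0 = b≡0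

  a*a≡0⇒a≡0 : ∀ {a} → a * a ≡ 0# → a ≡ 0#
  a*a≡0⇒a≡0 {a} aa≡0 = reduce (integral a a aa≡0)

  a-b≡0⇒a≡b : ∀ {a b} → a - b ≡ 0# → a ≡ b
  a-b≡0⇒a≡b {a} {b} a-b≡0 = begin
    a            ≡⟨ solve 2 (λ a b → a := a :- b :+ b) refl a b ⟩
    a - b + b    ≡⟨ cong (_+ b) a-b≡0 ⟩
    0# + b       ≡⟨ solve 1 (λ b → con (+ 0) :+ b := b) refl b ⟩
    b            ∎
    where open ≡-Reasoning

  a≡b⇒a-b≡0 : ∀ {a b} → a ≡ b → a - b ≡ 0#
  a≡b⇒a-b≡0 {a} refl = solve 1 (λ a → a :- a := con (+ 0)) refl a

  x≡0⇒a*x≡0 : ∀ a {x} → x ≡ 0# → a * x ≡ 0#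
  x≡0⇒a*x≡0 a refl = solve 1 (λ a → a :* con (+ 0) := con (+ 0)) refl a

  x≡0∧y≡0⇒x+y≡0 : ∀ {x y} → x ≡ 0# → y ≡ 0# → x + y ≡ 0#
  x≡0∧y≡0⇒x+y≡0 refl refl = solve 0 (con (+ 0) :+ con (+ 0) := con (+ 0)) refl

  x≡0∧y≡0⇒x-y≡0 : ∀ {x y} → x ≡ 0# → y ≡ 0# → x - y ≡ 0#
  x≡0∧y≡0⇒x-y≡0 refl refl = solve 0 (con (+ 0) :- con (+ 0) := con (+ 0)) refl

  -- The solver sees an inverse as a free variable. Identities involving division therefore carry a
  -- multiple of this expression as a correction term, which is then discarded.
  1-a*a⁻¹≡0 : ∀ {a} → a ≢ 0# → 1# - a * a ⁻¹ ≡ 0#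
  1-a*a⁻¹≡0 a≢0 = a≡b⇒a-b≡0 (sym (*-inverseʳ a≢0))

-- Algebra of the equations f = f_y = f_z = 0.

module Surface (𝕂 : Field) (2≢0 : Field.fromℤ 𝕂 (+ 2) ≢ Field.0# 𝕂) (C D : Field.Carrier 𝕂) where

  open Field 𝕂
  open Solver

  private
    2# 4# 8# 16# -2# : Carrier
    2#  = fromℤ (+ 2)
    4#  = fromℤ (+ 4)
    8#  = fromℤ (+ 8)
    16# = fromℤ (+ 16)
    -2# = fromℤ -[1+ 1 ]

  4≢0 : 4# ≢ 0#
  4≢0 4≡0 = 2≢0 (a*a≡0⇒a≡0 (trans (solve 0 (con (+ 2) :* con (+ 2) := con (+ 4)) refl) 4≡0))

  8≢0 : 8# ≢ 0#
  8≢0 8≡0 = 4≢0 (a≢0∧a*b≡0⇒b≡0 2≢0 (trans (solve 0 (con (+ 2) :* con (+ 4) := con (+ 8)) refl) 8≡0))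

  F F-y F-z : Carrier → Carrier → Carrier → Carrier
  F   x y z = x * x + y * y + z * z - x * y * z + C * (x + y + z) - D
  F-y x y z = 2# * y - x * z + C
  F-z x y z = 2# * z - x * y + C

  K : Carrier → Carrier
  K x = x * x * x + (C - 2#) * (x * x) - (2# * C + D) * x + (C * C + 2# * D)

  record Solution (x y z : Carrier) : Set where
    constructor mk
    field
      F≡0   : F x y z ≡ 0#
      F-y≡0 : F-y x y z ≡ 0#
      F-z≡0 : F-z x y z ≡ 0#

  -- 4 (D∙ - D), free of denominators.
  Δ : Carrier
  Δ = 16# - 8# * C - C * C - 4# * D

  private
    `F : ∀ {n} (C D x y z : Polynomial n) → Polynomial n
    `F C D x y z = x :* x :+ y :* y :+ z :* z :- x :* y :* z :+ C :* (x :+ y :+ z) :- D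

    `F-y `F-z : ∀ {n} (C x y z : Polynomial n) → Polynomial n
    `F-y C x y z = con (+ 2) :* y :- x :* z :+ C
    `F-z C x y z = con (+ 2) :* z :- x :* y :+ C

    `K : ∀ {n} (C D x : Polynomial n) → Polynomial n
    `K C D x = x :* x :* x :+ (C :- con (+ 2)) :* (x :* x) :- (con (+ 2) :* C :+ D) :* x
      :+ (C :* C :+ con (+ 2) :* D)

    `Δ : ∀ {n} (C D : Polynomial n) → Polynomial n
    `Δ C D = con (+ 16) :- con (+ 8) :* C :- C :* C :- con (+ 4) :* D

    `-2 : ∀ {n} → Polynomial n
    `-2 = con -[1+ 1 ]

  F-y-F-z : ∀ x y z → (x + 2#) * (y - z) ≡ F-y x y z - F-z x y z
  F-y-F-z = solve 4 (λ C x y z → (x :+ con (+ 2)) :* (y :- z) := `F-y C x y z :- `F-z C x y z) refl C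

  -- Completing the square: as a quadratic in y, `F x y y` has leading coefficient 2 - x, half its
  -- derivative is `F-y x y y`, and a quarter of its discriminant is `K x`. The factor
  -- `C - (x - 2#) * y` is `F-y x y y` again.
  κ-F : ∀ x y → K x ≡ (x - 2#) * F x y y + (C - (x - 2#) * y) * F-y x y y
  κ-F = solve 4 (λ C D x y → `K C D x :=
    (x :- con (+ 2)) :* `F C D x y y :+ (C :- (x :- con (+ 2)) :* y) :* `F-y C x y y) refl C D

  -- F-y x (-2) (-2) = 2x + C - 4, whose square is the double factor of 4κ at D = D∙.
  4κ-Δ : ∀ x → 4# * K x ≡ (x + 2#) * (F-y x -2# -2# * F-y x -2# -2#) + (x - 2#) * Δ
  4κ-Δ = solve 3 (λ C D x → con (+ 4) :* `K C D x :=
    (x :+ con (+ 2)) :* (`F-y C x `-2 `-2 :* `F-y C x `-2 `-2) :+ (x :- con (+ 2)) :* `Δ C D) refl C D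

  -- At x = -2 both f and f_y depend on y + z alone, and f is a monic quadratic in it with
  -- derivative f_y.
  4F[-2] : ∀ y z → 4# * F -2# y z ≡ F-y -2# y z * F-y -2# y z + Δ
  4F[-2] = solve 4 (λ C D y z → con (+ 4) :* `F C D `-2 y z := `F-y C `-2 y z :* `F-y C `-2 y z :+ `Δ C D) refl C D

  -- At x = 2 the terms in y² cancel: f is linear in y and f_y is the constant C.
  4F[2] : ∀ y → 4# * F 2# y y ≡ (16# + C + 8# * y) * F-y 2# y y + Δ
  4F[2] = solve 3 (λ C D y → con (+ 4) :* `F C D (con (+ 2)) y y :=
    (con (+ 16) :+ C :+ con (+ 8) :* y) :* `F-y C (con (+ 2)) y y :+ `Δ C D) refl C D

  -- By the symmetry of f, this is the completed square on the plane x = -2 with the coordinates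
  -- permuted.
  4F[-2,-2] : ∀ x → 4# * F x -2# -2# ≡ F-y x -2# -2# * F-y x -2# -2# + Δ
  4F[-2,-2] = solve 3 (λ C D x → con (+ 4) :* `F C D x `-2 `-2 :=
    `F-y C x `-2 `-2 :* `F-y C x `-2 `-2 :+ `Δ C D) refl C D

  4[D∙-D] : 4# * (4# - 2# * C - C * C / 4# - D) ≡ Δ + C * C * (1# - 4# * 4# ⁻¹)
  4[D∙-D] = solve 3 (λ C D i → con (+ 4) :* (con (+ 4) :- con (+ 2) :* C :- C :* C :* i :- D)
    := `Δ C D :+ C :* C :* (con (+ 1) :- con (+ 4) :* i)) refl C D (4# ⁻¹)

  Δ≡0⇒D≡D∙ : Δ ≡ 0# → D ≡ 4# - 2# * C - C * C / 4#
  Δ≡0⇒D≡D∙ Δ≡0 = sym (a-b≡0⇒a≡b (a≢0∧a*b≡0⇒b≡0 4≢0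
    (trans 4[D∙-D] (x≡0∧y≡0⇒x+y≡0 Δ≡0 (x≡0⇒a*x≡0 (C * C) (1-a*a⁻¹≡0 4≢0))))))

  d≡a*b+c⇒c≡0 : ∀ {a b c d} → d ≡ a * b + c → d ≡ 0# → b ≡ 0# → c ≡ 0#
  d≡a*b+c⇒c≡0 {a} {b} {c} {d} d≡ d≡0 b≡0 = trans
    (solve 2 (λ e c → c := e :+ c :- e) refl (a * b) c) (x≡0∧y≡0⇒x-y≡0 (trans (sym d≡) d≡0) (x≡0⇒a*x≡0 a b≡0))

  D≡D∙⇒Δ≡0 : D ≡ 4# - 2# * C - C * C / 4# → Δ ≡ 0#
  D≡D∙⇒Δ≡0 D≡D∙ = d≡a*b+c⇒c≡0 (trans 4[D∙-D] (+-comm _ _)) (x≡0⇒a*x≡0 4# (a≡b⇒a-b≡0 (sym D≡D∙))) (1-a*a⁻¹≡0 4≢0)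

  solution⇒x≡-2∨y≡z : ∀ {x y z} → Solution x y z → x ≡ -2# ⊎ y ≡ z
  solution⇒x≡-2∨y≡z {x} {y} {z} (mk _ Fy≡0 Fz≡0)
    with integral (x + 2#) (y - z) (trans (F-y-F-z x y z) (x≡0∧y≡0⇒x-y≡0 Fy≡0 Fz≡0))
  ... | inj₁ x+2≡0 = inj₁ (a-b≡0⇒a≡b (trans (solve 1 (λ x → x :- `-2 := x :+ con (+ 2)) refl x) x+2≡0))
  ... | inj₂ y-z≡0 = inj₂ (a-b≡0⇒a≡b y-z≡0)

  solution[-2]⇒Δ≡0 : ∀ {y z} → Solution -2# y z → Δ ≡ 0#
  solution[-2]⇒Δ≡0 {y} {z} (mk F≡0 Fy≡0 _) = d≡a*b+c⇒c≡0 (4F[-2] y z) (x≡0⇒a*x≡0 4# F≡0) Fy≡0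

  solution[2]⇒Δ≡0 : ∀ {y} → Solution 2# y y → Δ ≡ 0#
  solution[2]⇒Δ≡0 {y} (mk F≡0 Fy≡0 _) = d≡a*b+c⇒c≡0 (4F[2] y) (x≡0⇒a*x≡0 4# F≡0) Fy≡0

  4F≡a*F-y+Δ⇒F≡0 : ∀ {a b c} → 4# * c ≡ a * b + Δ → Δ ≡ 0# → b ≡ 0# → c ≡ 0#
  4F≡a*F-y+Δ⇒F≡0 {a} 4c≡ Δ≡0 b≡0 = a≢0∧a*b≡0⇒b≡0 4≢0 (trans 4c≡ (x≡0∧y≡0⇒x+y≡0 (x≡0⇒a*x≡0 a b≡0) Δ≡0))

  solution[2] : Δ ≡ 0# → C ≡ 0# → ∀ y → Solution 2# y y
  -- For y = z the expressions `F-y` and `F-z` coincide definitionally, so one proof serves both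
  -- equations.
  solution[2] Δ≡0 C≡0 y = mk (4F≡a*F-y+Δ⇒F≡0 (4F[2] y) Δ≡0 Fy≡0) Fy≡0 Fy≡0
    where
    Fy≡0 : F-y 2# y y ≡ 0#
    Fy≡0 = trans (solve 2 (λ C y → `F-y C (con (+ 2)) y y := C) refl C y) C≡0

  -- The value of z solving 2y + 2z + C = 0, which is f_y = 0 at x = -2.
  line-z : Carrier → Carrier
  line-z y = - y - C / 2#

  solution-line : Δ ≡ 0# → ∀ y → Solution -2# y (line-z y)
  solution-line Δ≡0 y = mk (4F≡a*F-y+Δ⇒F≡0 (4F[-2] y z) Δ≡0 Fy≡0) Fy≡0
    (trans (solve 3 (λ C y z → `F-z C `-2 y z := `F-y C `-2 y z) refl C y z) Fy≡0)
    where
    z : Carrier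
    z = line-z y
    Fy≡0 : F-y -2# y z ≡ 0#
    Fy≡0 = trans (solve 3 (λ C y i → `F-y C `-2 y (:- y :- C :* i) := C :* (con (+ 1) :- con (+ 2) :* i))
      refl C y (2# ⁻¹)) (x≡0⇒a*x≡0 C (1-a*a⁻¹≡0 2≢0))

  solution[-2]⇒line : ∀ {y z} → Solution -2# y z → z ≡ line-z y
  solution[-2]⇒line {y} {z} (mk _ Fy≡0 _) = a-b≡0⇒a≡b (a≢0∧a*b≡0⇒b≡0 2≢0 (trans
    (solve 4 (λ C y z i → con (+ 2) :* (z :- (:- y :- C :* i)) :=
      `F-y C `-2 y z :- C :* (con (+ 1) :- con (+ 2) :* i)) refl C y z (2# ⁻¹))
    (x≡0∧y≡0⇒x-y≡0 Fy≡0 (x≡0⇒a*x≡0 C (1-a*a⁻¹≡0 2≢0)))))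

  double-root : Carrier
  double-root = (4# - C) / 2#

  F-y[double-root] : F-y double-root -2# -2# ≡ 0#
  F-y[double-root] = trans
    (solve 2 (λ C i → `F-y C ((con (+ 4) :- C) :* i) `-2 `-2 := (C :- con (+ 4)) :* (con (+ 1) :- con (+ 2) :* i))
      refl C (2# ⁻¹))
    (x≡0⇒a*x≡0 (C - 4#) (1-a*a⁻¹≡0 2≢0))

  -- The form 2x + C - 4 is linear in x with invertible leading coefficient 2, so its zero,
  -- `double-root`, is unique.
  F-y[x,-2,-2]-injective : ∀ {x x′} → F-y x -2# -2# ≡ 0# → F-y x′ -2# -2# ≡ 0# → x ≡ x′
  F-y[x,-2,-2]-injective {x} {x′} Fy≡0 Fy′≡0 = a-b≡0⇒a≡b (a≢0∧a*b≡0⇒b≡0 2≢0 (trans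
    (solve 3 (λ C x x′ → con (+ 2) :* (x :- x′) := `F-y C x `-2 `-2 :- `F-y C x′ `-2 `-2) refl C x x′)
    (x≡0∧y≡0⇒x-y≡0 Fy≡0 Fy′≡0)))

  double-root-solution : Δ ≡ 0# → Solution double-root -2# -2#
  double-root-solution Δ≡0 =
    mk (4F≡a*F-y+Δ⇒F≡0 (4F[-2,-2] double-root) Δ≡0 F-y[double-root]) F-y[double-root] F-y[double-root]

  -- The values of 2x + C - 4 at 2 and -2 are C and C - 8. Hence the exceptional cases C = 0, where
  -- the double root is 2, and C = 8, where it is -2.
  F-y[2,-2,-2]≡C : F-y 2# -2# -2# ≡ C
  F-y[2,-2,-2]≡C = solve 1 (λ C → `F-y C (con (+ 2)) `-2 `-2 := C) refl C

  F-y[-2,-2,-2]≡C-8 : F-y -2# -2# -2# ≡ C - 8#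
  F-y[-2,-2,-2]≡C-8 = solve 1 (λ C → `F-y C `-2 `-2 `-2 := C :- con (+ 8)) refl C

  C≡0⇒double-root≡2 : C ≡ 0# → double-root ≡ 2#
  C≡0⇒double-root≡2 C≡0 = F-y[x,-2,-2]-injective F-y[double-root] (trans F-y[2,-2,-2]≡C C≡0)

  C≡8⇒double-root≡-2 : C ≡ 8# → double-root ≡ -2#
  C≡8⇒double-root≡-2 C≡8 = F-y[x,-2,-2]-injective F-y[double-root] (trans F-y[-2,-2,-2]≡C-8 (a≡b⇒a-b≡0 C≡8))

  double-root≡-2⇒C≡8 : double-root ≡ -2# → C ≡ 8#
  double-root≡-2⇒C≡8 r≡-2 = a-b≡0⇒a≡b (trans (sym F-y[-2,-2,-2]≡C-8)
    (subst (λ r → F-y r -2# -2# ≡ 0#) r≡-2 F-y[double-root]))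

  solution-diagonal⇒root : ∀ {x y} → Solution x y y → K x ≡ 0#
  solution-diagonal⇒root {x} {y} (mk F≡0 Fy≡0 _) =
    trans (κ-F x y) (x≡0∧y≡0⇒x+y≡0 (x≡0⇒a*x≡0 _ F≡0) (x≡0⇒a*x≡0 _ Fy≡0))

  -- Here κ(x) = 0, and `4κ-Δ` with Δ = 0 reads 4κ(x) = (x + 2)(2x + C - 4)². The factor x + 2 is
  -- nonzero, so the square vanishes.
  solution-diagonal⇒double-root : Δ ≡ 0# → ∀ {x y} → x ≢ -2# → Solution x y y → x ≡ double-root
  solution-diagonal⇒double-root Δ≡0 {x} {y} x≢-2 sol =
    F-y[x,-2,-2]-injective (a*a≡0⇒a≡0 (a≢0∧a*b≡0⇒b≡0 x+2≢0 square≡0)) F-y[double-root]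
    where
    x+2≢0 : x + 2# ≢ 0#
    x+2≢0 x+2≡0 = x≢-2 (a-b≡0⇒a≡b (trans (solve 1 (λ x → x :- `-2 := x :+ con (+ 2)) refl x) x+2≡0))
    square≡0 : (x + 2#) * (F-y x -2# -2# * F-y x -2# -2#) ≡ 0#
    square≡0 = d≡a*b+c⇒c≡0 (trans (4κ-Δ x) (+-comm _ _))
      (x≡0⇒a*x≡0 4# (solution-diagonal⇒root sol)) Δ≡0

  -- Eliminating x between f_y = 0 at (x, y, y) and at (x, -2, -2) leaves C (y + 2) = 0.
  solution-double-root⇒C≡0∨y≡-2 : ∀ {y} → Solution double-root y y → C ≡ 0# ⊎ y ≡ -2#
  solution-double-root⇒C≡0∨y≡-2 {y} (mk _ Fy≡0 _)
    with integral C (y - -2#) (trans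
      (solve 3 (λ C x y → C :* (y :- `-2) := con (+ 2) :* `F-y C x y y :+ y :* `F-y C x `-2 `-2) refl C double-root y)
      (x≡0∧y≡0⇒x+y≡0 (x≡0⇒a*x≡0 2# Fy≡0) (x≡0⇒a*x≡0 y F-y[double-root])))
  ... | inj₁ C≡0   = inj₁ C≡0
  ... | inj₂ y+2≡0 = inj₂ (a-b≡0⇒a≡b y+2≡0)

  diagonal-y : Carrier → Carrier
  diagonal-y x = C / (x - 2#)

  solution⇒diagonal-y : ∀ {x y} → x ≢ 2# → Solution x y y → y ≡ diagonal-y x
  solution⇒diagonal-y {x} {y} x≢2 (mk _ Fy≡0 _) = a-b≡0⇒a≡b (a≢0∧a*b≡0⇒b≡0 (x≢2 ∘ a-b≡0⇒a≡b) (trans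
    (solve 4 (λ C x y i → (x :- con (+ 2)) :* (y :- C :* i) :=
      C :* (con (+ 1) :- (x :- con (+ 2)) :* i) :- `F-y C x y y) refl C x y ((x - 2#) ⁻¹))
    (x≡0∧y≡0⇒x-y≡0 (x≡0⇒a*x≡0 C (1-a*a⁻¹≡0 (x≢2 ∘ a-b≡0⇒a≡b))) Fy≡0)))

  root⇒solution : ∀ {x} → x ≢ 2# → K x ≡ 0# → Solution x (diagonal-y x) (diagonal-y x)
  root⇒solution {x} x≢2 Kx≡0 = mk F≡0 Fy≡0 Fy≡0
    where
    y : Carrier
    y = diagonal-y x
    Fy≡0 : F-y x y y ≡ 0#
    Fy≡0 = trans
      (solve 3 (λ C x i → `F-y C x (C :* i) (C :* i) := C :* (con (+ 1) :- (x :- con (+ 2)) :* i)) refl C x ((x - 2#) ⁻¹))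
      (x≡0⇒a*x≡0 C (1-a*a⁻¹≡0 (x≢2 ∘ a-b≡0⇒a≡b)))
    F≡0 : F x y y ≡ 0#
    -- With κ(x) = 0 and f_y = 0, `κ-F` leaves (x - 2) f = 0, and x - 2 cancels.
    F≡0 = a≢0∧a*b≡0⇒b≡0 (x≢2 ∘ a-b≡0⇒a≡b)
      (d≡a*b+c⇒c≡0 (trans (κ-F x y) (+-comm _ _)) Kx≡0 Fy≡0)

  K[2]≡C*C : K 2# ≡ C * C
  K[2]≡C*C = solve 2 (λ C D → `K C D (con (+ 2)) := C :* C) refl C D

-- Counting the solutions over a finite field.

module Count (𝕂 : Field) (2≢0 : Field.fromℤ 𝕂 (+ 2) ≢ Field.0# 𝕂) (C D : Field.Carrier 𝕂)
  (_≟_ : DecidableEquality (Field.Carrier 𝕂)) (carrier : Enumeration (U {A = Field.Carrier 𝕂})) where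

  open Field 𝕂
  open Surface 𝕂 2≢0 C D
  open Enumeration

  private
    2# 8# -2# : Carrier
    2#  = fromℤ (+ 2)
    8#  = fromℤ (+ 8)
    -2# = fromℤ -[1+ 1 ]

  SolutionTriple : Carrier × Carrier × Carrier → Set
  SolutionTriple (x , y , z) = Solution x y z

  Root : Carrier → Set
  Root x = K x ≡ 0#

  -- The case D ≠ D∙: solutions and roots of κ.

  module Δ-nonzero (Δ≢0 : Δ ≢ 0#) where

    -- These are exactly the x-coordinates of solutions, each carrying a single solution.
    roots≢2 : Enumeration (λ x → Root x × x ≢ 2#)
    roots≢2 = enumerate (λ x → (K x ≟ 0#) ×-dec ¬? (x ≟ 2#)) carrier

    point : Carrier → Carrier × Carrier × Carrier
    point x = x , diagonal-y x , diagonal-y x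

    solution⇒∈ : ∀ {x y z} → Solution x y z → (x , y , z) ∈ map point (list roots≢2)
    solution⇒∈ {x} sol with solution⇒x≡-2∨y≡z sol
    ... | inj₁ refl = contradiction (solution[-2]⇒Δ≡0 sol) Δ≢0
    ... | inj₂ refl = subst (λ y → (x , y , y) ∈ map point (list roots≢2)) (sym (solution⇒diagonal-y x≢2 sol))
        (∈-map⁺ point (complete roots≢2 (solution-diagonal⇒root sol , x≢2)))
      where
      x≢2 : x ≢ 2#
      x≢2 refl = Δ≢0 (solution[2]⇒Δ≡0 sol)

    ∈⇒solution : ∀ {x y z} → (x , y , z) ∈ map point (list roots≢2) → Solution x y z
    ∈⇒solution t∈ with x , x∈ , refl ← ∈-map⁻ point t∈
                  with Kx≡0 , x≢2 ← sound roots≢2 x∈ = root⇒solution x≢2 Kx≡0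

    size-solutions : (S : Enumeration SolutionTriple) → size S ≡ size roots≢2
    size-solutions S = trans (size-unique S (record
      { list     = map point (list roots≢2)
      ; unique   = Unique.map⁺ (cong proj₁) (unique roots≢2)
      ; complete = solution⇒∈
      ; sound    = ∈⇒solution
      })) (length-map point (list roots≢2))

    -- Since κ(2) = C², the element 2 is a root precisely when C = 0; this root carries no solution
    -- and accounts for the bracket.
    size-roots : (R : Enumeration Root) → size R ≡ size roots≢2 ℕ.+ ⟦ C ≟ 0# ⟧
    size-roots R with C ≟ 0#
    ... | yes C≡0 = trans (size-unique R (record
      { list     = 2# ∷ list roots≢2
      ; unique   = All.tabulate (λ x∈ 2≡x → proj₂ (sound roots≢2 x∈) (sym 2≡x)) ∷ unique roots≢2
      ; complete = λ {x} Kx≡0 → case (x ≟ 2#) of λ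
          { (yes refl) → here refl ; (no x≢2) → there (complete roots≢2 (Kx≡0 , x≢2)) }
      ; sound    = λ { (here refl) → trans K[2]≡C*C (x≡0⇒a*x≡0 C C≡0) ; (there x∈) → proj₁ (sound roots≢2 x∈) }
      })) (ℕ.+-comm 1 (size roots≢2))
    ... | no C≢0 = trans (size-unique R (transport proj₁
      (λ Kx≡0 → Kx≡0 , λ { refl → C≢0 (a*a≡0⇒a≡0 (trans (sym K[2]≡C*C) Kx≡0)) }) roots≢2))
      (sym (ℕ.+-identityʳ (size roots≢2)))

    size-solutions+⟦C≡0⟧ : (S : Enumeration SolutionTriple) (R : Enumeration Root) → size S ℕ.+ ⟦ C ≟ 0# ⟧ ≡ size R
    size-solutions+⟦C≡0⟧ S R = trans (cong (ℕ._+ ⟦ C ≟ 0# ⟧) (size-solutions S)) (sym (size-roots R))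

  -- The case D = D∙: lines and an isolated point.

  module Δ-zero (Δ≡0 : Δ ≡ 0#) where

    on-line : Carrier → Carrier × Carrier × Carrier
    on-line y = -2# , y , line-z y

    line : List (Carrier × Carrier × Carrier)
    line = map on-line (list carrier)

    line! : Unique line
    line! = Unique.map⁺ (cong (proj₁ ∘ proj₂)) (unique carrier)

    solution[-2]⇒∈line : ∀ {y z} → Solution -2# y z → (-2# , y , z) ∈ line
    solution[-2]⇒∈line {y} sol = subst (λ z → (-2# , y , z) ∈ line) (sym (solution[-2]⇒line sol))
      (∈-map⁺ on-line (complete carrier _))

    ∈line⇒solution : ∀ {x y z} → (x , y , z) ∈ line → Solution x y z
    ∈line⇒solution t∈ with y , _ , refl ← ∈-map⁻ on-line t∈ = solution-line Δ≡0 y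

    ∈line⇒x≡-2 : ∀ {x y z} → (x , y , z) ∈ line → x ≡ -2#
    ∈line⇒x≡-2 t∈ with _ , _ , refl ← ∈-map⁻ on-line t∈ = refl

    diagonal : Carrier → Carrier × Carrier × Carrier
    diagonal y = 2# , y , y

    -- Off the plane x = -2 every solution has the form (r, y, y) with r the double root. The three
    -- cases below differ in what remains: a whole line for C = 0, nothing for C = 8, and one point
    -- otherwise.
    solution⇒x≡-2∨double-root : ∀ {x y z} → Solution x y z →
      x ≡ -2# ⊎ (x ≢ -2# × x ≡ double-root × y ≡ z × (C ≡ 0# ⊎ y ≡ -2#))
    solution⇒x≡-2∨double-root {x} {y} sol with x ≟ -2#
    ... | yes x≡-2 = inj₁ x≡-2
    ... | no x≢-2 with solution⇒x≡-2∨y≡z sol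
    ... | inj₁ x≡-2 = contradiction x≡-2 x≢-2
    ... | inj₂ refl = inj₂ (x≢-2 , x≡r , refl ,
        solution-double-root⇒C≡0∨y≡-2 (subst (λ x → Solution x y y) x≡r sol))
      where
      x≡r : x ≡ double-root
      x≡r = solution-diagonal⇒double-root Δ≡0 x≢-2 sol

    module Case-C≡0 (C≡0 : C ≡ 0#) where

      solution⇒∈ : ∀ {x y z} → Solution x y z → (x , y , z) ∈ line ++ map diagonal (list carrier)
      solution⇒∈ {y = y} sol with solution⇒x≡-2∨double-root sol
      ... | inj₁ refl = ∈-++⁺ˡ (solution[-2]⇒∈line sol)
      ... | inj₂ (_ , refl , refl , _) = ∈-++⁺ʳ line
        (subst (λ x → (x , y , y) ∈ map diagonal (list carrier)) (sym (C≡0⇒double-root≡2 C≡0))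
          (∈-map⁺ diagonal (complete carrier _)))

      ∈⇒solution : ∀ {x y z} → (x , y , z) ∈ line ++ map diagonal (list carrier) → Solution x y z
      ∈⇒solution t∈ with ∈-++⁻ line t∈
      ... | inj₁ t∈line = ∈line⇒solution t∈line
      ... | inj₂ t∈diagonal with y , _ , refl ← ∈-map⁻ diagonal t∈diagonal = solution[2] Δ≡0 C≡0 y

      line++diagonal! : Unique (line ++ map diagonal (list carrier))
      line++diagonal! = Unique.++⁺ line! (Unique.map⁺ (cong (proj₁ ∘ proj₂)) (unique carrier)) disjoint
        where
        disjoint : ∀ {t} → ¬ (t ∈ line × t ∈ map diagonal (list carrier))
        -- A common point would have x = 2 = -2. Then the double root, being 2, is also -2, which
        -- forces C = 8 and, with C = 0, gives 8 = 0.
        disjoint (t∈line , t∈diagonal) with _ , _ , refl ← ∈-map⁻ diagonal t∈diagonal =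
          8≢0 (trans (sym (double-root≡-2⇒C≡8 (trans (C≡0⇒double-root≡2 C≡0) (∈line⇒x≡-2 t∈line)))) C≡0)

      solutions : Enumeration SolutionTriple
      solutions = record
        { list     = line ++ map diagonal (list carrier)
        ; unique   = line++diagonal!
        ; complete = solution⇒∈
        ; sound    = ∈⇒solution
        }

      size-solutions : size solutions ≡ size carrier ℕ.+ size carrier
      size-solutions = trans (length-++ line)
        (cong₂ ℕ._+_ (length-map on-line (list carrier)) (length-map diagonal (list carrier)))

    module Case-C≡8 (C≡8 : C ≡ 8#) where

      solution⇒∈ : ∀ {x y z} → Solution x y z → (x , y , z) ∈ line
      solution⇒∈ sol with solution⇒x≡-2∨double-root sol
      ... | inj₁ refl = solution[-2]⇒∈line sol
      ... | inj₂ (x≢-2 , x≡r , _) = contradiction (trans x≡r (C≡8⇒double-root≡-2 C≡8)) x≢-2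

      solutions : Enumeration SolutionTriple
      solutions = record { list = line ; unique = line! ; complete = solution⇒∈ ; sound = ∈line⇒solution }

    module Case-C≢0,8 (C≢0 : C ≢ 0#) (C≢8 : C ≢ 8#) where

      isolated : Carrier × Carrier × Carrier
      isolated = double-root , -2# , -2#

      solution⇒∈ : ∀ {x y z} → Solution x y z → (x , y , z) ∈ isolated ∷ line
      solution⇒∈ sol with solution⇒x≡-2∨double-root sol
      ... | inj₁ refl = there (solution[-2]⇒∈line sol)
      ... | inj₂ (_ , _ , _ , inj₁ C≡0) = contradiction C≡0 C≢0
      ... | inj₂ (_ , refl , refl , inj₂ refl) = here refl

      ∈⇒solution : ∀ {x y z} → (x , y , z) ∈ isolated ∷ line → Solution x y z
      ∈⇒solution (here refl)    = double-root-solution Δ≡0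
      ∈⇒solution (there t∈line) = ∈line⇒solution t∈line

      isolated∷line! : Unique (isolated ∷ line)
      isolated∷line! = All.tabulate (λ { t∈line refl → C≢8 (double-root≡-2⇒C≡8 (∈line⇒x≡-2 t∈line)) }) ∷ line!

      solutions : Enumeration SolutionTriple
      solutions = record { list = isolated ∷ line ; unique = isolated∷line! ; complete = solution⇒∈ ; sound = ∈⇒solution }

    size-solutions+⟦C≡0⟧+⟦C≡8⟧ : (S : Enumeration SolutionTriple) →
      size S ℕ.+ (⟦ C ≟ 0# ⟧ ℕ.+ ⟦ C ≟ 8# ⟧) ≡ (1 ℕ.+ ⟦ C ≟ 0# ⟧) ℕ.* size carrier ℕ.+ 1
    size-solutions+⟦C≡0⟧+⟦C≡8⟧ S with C ≟ 0# | C ≟ 8#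
    -- The two brackets are never both 1, as 2 and hence 8 is nonzero.
    ... | yes C≡0 | yes C≡8 = contradiction (trans (sym C≡8) C≡0) 8≢0
    ... | yes C≡0 | no _
      rewrite size-unique S (Case-C≡0.solutions C≡0) | Case-C≡0.size-solutions C≡0 | ℕ.+-identityʳ (size carrier) = refl
    ... | no _    | yes C≡8
      rewrite size-unique S (Case-C≡8.solutions C≡8) | length-map on-line (list carrier) | ℕ.+-identityʳ (size carrier) = refl
    ... | no C≢0  | no C≢8
      rewrite size-unique S (Case-C≢0,8.solutions C≢0 C≢8) | length-map on-line (list carrier)
      | ℕ.+-identityʳ (size carrier) = ℕ.+-comm 1 (size carrier)

-- The residues modulo a prime form a field.

module _ (p : ℕ) .{{_ : NonZero p}} (prime : Prime p) where

  private
    module R = Residues p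
    module Cong = Congruence p
  open R using (_⁻¹)
  open Cong using (∣∧<⇒≡0; ~∧≡0⇒∣; toℕ≡0⇒≡0; fromℤ; fromℤ-~; ~-injective; +-~; *-~; -‿~)

  𝔽-field : Field
  𝔽-field = record
    { Carrier = 𝔽 p ; _+_ = R._+_ ; _*_ = R._*_ ; -_ = λ a → R.- a ; _⁻¹ = _⁻¹ ; fromℤ = fromℤ
    ; isCommutativeRing = CommutativeRing.isCommutativeRing Cong.commutativeRing
    ; +-homo = λ m n → ~-injective (fromℤ-~ (m ℤ.+ n)) (+-~ (fromℤ-~ m) (fromℤ-~ n))
    ; *-homo = λ m n → ~-injective (fromℤ-~ (m ℤ.* n)) (*-~ (fromℤ-~ m) (fromℤ-~ n))
    ; -‿homo = λ m → ~-injective (fromℤ-~ (ℤ.- m)) (-‿~ (fromℤ-~ m))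
    ; integral = integral
    ; *-inverseʳ = *-inverseʳ
    }
    where
    integral : ∀ a b → a R.* b ≡ fromℕ p 0 → a ≡ fromℕ p 0 ⊎ b ≡ fromℕ p 0
    integral a b ab≡0 = Sum.map (zero-if a) (zero-if b)
      (euclidsLemma (toℕ a) (toℕ b) prime (~∧≡0⇒∣ (Cong.fromℕ-~ (toℕ a ℕ.* toℕ b)) ab≡0))
      where
      zero-if : ∀ c → p ℕ.∣ toℕ c → c ≡ fromℕ p 0
      zero-if c p∣c = toℕ≡0⇒≡0 (∣∧<⇒≡0 p∣c (toℕ<n c))
    *-inverseʳ : ∀ {a} → a ≢ fromℕ p 0 → a R.* a ⁻¹ ≡ fromℕ p 1
    *-inverseʳ {a} a≢0 with b , ab≡1 ←
      Cong.coprime⇒invertible a (prime⇒coprime prime {{ℕ.≢-nonZero (a≢0 ∘ toℕ≡0⇒≡0)}} (toℕ<n a)) =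
      find-satisfies (λ b → a R.* b ≟ fromℕ p 1) (fromℕ p 0) (∈-allFin b) ab≡1

-- From formal polynomials and their derivatives to explicit equations.

module Concrete (p : ℕ) .{{_ : NonZero p}} (prime : Prime p) (5≤p : 5 ≤ p) (C D : 𝔽 p) where

  private
    2≢0 : fromℕ p 2 ≢ fromℕ p 0
    2≢0 = Congruence.fromℕ≢0 p 2 (ℕ.≤-trans (ℕ.m≤m+n 3 2) 5≤p)

  open Residues p using (eval; Root; root?; ∂)
  open Field (𝔽-field p prime) using (module Solver)
  open Surface (𝔽-field p prime) 2≢0 C D public
  open Count (𝔽-field p prime) 2≢0 C D _≟_ (enumerate-Fin p) public hiding (Root)

  module _ where
    open Solver

    private
      -- The power `x ↑ 2` unfolds to a product ending in the constant 1, and solver expressions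
      -- have to match this evaluation literally.
      sq : ∀ {n} → Polynomial n → Polynomial n
      sq x = x :* (x :* con (+ 1))

      dsq : ∀ {n} (x dx : Polynomial n) → Polynomial n
      dsq x dx = dx :* (x :* con (+ 1)) :+ x :* (dx :* con (+ 1) :+ x :* con (+ 0))

      -- ∂ does not simplify; these are its literal values.
      df : ∀ {n} (dx dy dz C x y z : Polynomial n) → Polynomial n
      df dx dy dz C x y z = dsq x dx :+ dsq y dy :+ dsq z dz :- ((dx :* y :+ x :* dy) :* z :+ x :* y :* dz)
        :+ (con (+ 0) :* (x :+ y :+ z) :+ C :* (dx :+ dy :+ dz)) :- con (+ 0)

    eval-f : ∀ x y z → eval (f p C D) (x ∷ y ∷ z ∷ []) ≡ F x y z
    eval-f = solve 5 (λ C D x y z →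
      sq x :+ sq y :+ sq z :- x :* y :* z :+ C :* (x :+ y :+ z) :- D :=
      x :* x :+ y :* y :+ z :* z :- x :* y :* z :+ C :* (x :+ y :+ z) :- D) refl C D

    eval-∂₁f : ∀ x y z → eval (∂ 1F (f p C D)) (x ∷ y ∷ z ∷ []) ≡ F-y x y z
    eval-∂₁f = solve 4 (λ C x y z → df (con (+ 0)) (con (+ 1)) (con (+ 0)) C x y z :=
      con (+ 2) :* y :- x :* z :+ C) refl C

    eval-∂₂f : ∀ x y z → eval (∂ 2F (f p C D)) (x ∷ y ∷ z ∷ []) ≡ F-z x y z
    eval-∂₂f = solve 4 (λ C x y z → df (con (+ 0)) (con (+ 0)) (con (+ 1)) C x y z :=
      con (+ 2) :* z :- x :* y :+ C) refl C

    eval-κ : ∀ x → eval (κ p C D) (x ∷ []) ≡ K x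
    eval-κ = solve 3 (λ C D x →
      x :* sq x :+ (C :- con (+ 2)) :* sq x :- (con (+ 2) :* C :+ D) :* x :+ (C :* C :+ con (+ 2) :* D) :=
      x :* x :* x :+ (C :- con (+ 2)) :* (x :* x) :- (con (+ 2) :* C :+ D) :* x :+ (C :* C :+ con (+ 2) :* D)) refl C D

  CommonRoot : 𝔽 p × 𝔽 p × 𝔽 p → Set
  CommonRoot (x , y , z) = Root (f p C D) v × Root (∂ 1F (f p C D)) v × Root (∂ 2F (f p C D)) v
    where v = x ∷ y ∷ z ∷ []

  commonRoot⇒solution : ∀ {x y z} → CommonRoot (x , y , z) → Solution x y z
  commonRoot⇒solution {x} {y} {z} (F≡0 , Fy≡0 , Fz≡0) =
    mk (trans (sym (eval-f x y z)) F≡0) (trans (sym (eval-∂₁f x y z)) Fy≡0) (trans (sym (eval-∂₂f x y z)) Fz≡0)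

  solution⇒commonRoot : ∀ {x y z} → Solution x y z → CommonRoot (x , y , z)
  solution⇒commonRoot {x} {y} {z} (mk F≡0 Fy≡0 Fz≡0) =
    trans (eval-f x y z) F≡0 , trans (eval-∂₁f x y z) Fy≡0 , trans (eval-∂₂f x y z) Fz≡0

  commonRoot? : Decidable CommonRoot
  commonRoot? (x , y , z) = root? (f p C D) v ×-dec root? (∂ 1F (f p C D)) v ×-dec root? (∂ 2F (f p C D)) v
    where v = x ∷ y ∷ z ∷ []

  -- As `transport` keeps the underlying list, `size solutions` unfolds to `N₂ p (f p C D)`; in the
  -- same way `size κ-roots` unfolds to `N₀ p (κ p C D)`.
  solutions : Enumeration SolutionTriple
  solutions = transport commonRoot⇒solution solution⇒commonRoot
    (enumerate commonRoot? (enumerate-Fin p ⊗ enumerate-Fin p ⊗ enumerate-Fin p))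

  κ-roots : Enumeration (λ x → K x ≡ fromℕ p 0)
  κ-roots = transport (λ {x} → trans (sym (eval-κ x))) (λ {x} → trans (eval-κ x))
    (enumerate (λ x → root? (κ p C D) (x ∷ [])) (enumerate-Fin p))

-- From additive counts in ℕ to the stated differences in ℤ.

open import Data.Integer using (_+_; _-_; _*_)

m+k≡n⇒m≡n-k : ∀ m k n → m ℕ.+ k ≡ n → + m ≡ + n - + k
m+k≡n⇒m≡n-k m k n refl = trans (ring (+ m) (+ k)) (cong (_- + k) (sym (ℤ.pos-+ m k)))
  where
  ring : ∀ m k → m ≡ m + k - k
  ring = solve-∀

theorem8p1 : (p : ℕ) .{{_ : NonZero p}} → Prime p → 5 ≤ p → (C D : 𝔽 p) →
    (D ≡ D∙ p C →
    + N₂ p (f p C D)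
    ≡ (+ 1 + + ⟦ C ≟ fromℕ p 0 ⟧) * + p + + 1 - + ⟦ C ≟ fromℕ p 0 ⟧ - + ⟦ C ≟ fromℕ p 8 ⟧)
    × (D ≢ D∙ p C →
    + N₂ p (f p C D) ≡ + N₀ p (κ p C D) - + ⟦ C ≟ fromℕ p 0 ⟧)
theorem8p1 p p-prime 5≤p C D =
  (λ D≡D∙ → trans
    (m+k≡n⇒m≡n-k _ _ _ (Δ-zero.size-solutions+⟦C≡0⟧+⟦C≡8⟧ (D≡D∙⇒Δ≡0 D≡D∙) solutions))
    -- The field is enumerated by `allFin p`, which is `tabulate id`, so its size is p.
    (trans (cong (λ n → + ((1 ℕ.+ a) ℕ.* n ℕ.+ 1) - + (a ℕ.+ b)) (length-tabulate {n = p} id)) regroup)) ,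
  (λ D≢D∙ → m+k≡n⇒m≡n-k _ _ _ (Δ-nonzero.size-solutions+⟦C≡0⟧ (D≢D∙ ∘ Δ≡0⇒D≡D∙) solutions κ-roots))
  where
  open Concrete p p-prime 5≤p C D
  a b : ℕ
  a = ⟦ C ≟ fromℕ p 0 ⟧
  b = ⟦ C ≟ fromℕ p 8 ⟧
  regroup : + ((1 ℕ.+ a) ℕ.* p ℕ.+ 1) - + (a ℕ.+ b) ≡ (+ 1 + + a) * + p + + 1 - + a - + b
  regroup = begin
    + ((1 ℕ.+ a) ℕ.* p ℕ.+ 1) - + (a ℕ.+ b)    ≡⟨ cong₂ _-_ (trans (ℤ.pos-+ ((1 ℕ.+ a) ℕ.* p) 1)
                                                     (cong (_+ + 1) (ℤ.pos-* (1 ℕ.+ a) p))) (ℤ.pos-+ a b) ⟩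
    + (1 ℕ.+ a) * + p + + 1 - (+ a + + b)      ≡⟨ ring (+ (1 ℕ.+ a) * + p + + 1) (+ a) (+ b) ⟩
    (+ 1 + + a) * + p + + 1 - + a - + b        ∎
    where
    open ≡-Reasoning
    ring : ∀ n a b → n - (a + b) ≡ n - a - b
    ring = solve-∀
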